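{- Let $X$ and $Y$ be real symmetric $n\times n$ matrices such that $X\succeq 0$ and $Y$ has zero diagonal. Let $A$ be the $(0,1)$-matrix whose support coincides with the support of $X\circ Y$ (so $A_{ij}=1$ if $X_{ij}Y_{ij}\neq 0$ and $A_{ij}=0$ otherwise), and let $G$ be the graph on $\{1,\dots,n\}$ with adjacency matrix $A$. Then $$\langle X,Y\rangle^2\ \le\ \left(1-\frac{1}{\chi_{\mathrm{vec}}(G)}\right)\langle X,X\rangle\,\langle Y,Y\rangle .$$
   Context: $\langle M,N\rangle=\mathrm{tr}(MN)$ on real symmetric matrices; $\circ$ is the entrywise product; $Z\ge 0$ means entrywise nonnegative; $Z\succeq 0$ means real symmetric positive semidefinite. For a finite simple graph $G$ whose complement has adjacency matrix $\overline{A}$, the vector chromatic number $\chi_{\mathrm{vec}}(G)$ is the maximum of $\langle J,Z\rangle$ ($J$ the all-ones matrix) over real symmetric $Z$ indexed by $V(G)$ with $\langle I,Z\rangle=1$, $Z\circ\overline{A}=0$, $Z\ge 0$, $Z\succeq 0$. -}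

module Defs where

open import Algebra.Bundles using (CommutativeRing)
open import Algebra.Core using (Op₁; Op₂)
open import Algebra.Definitions using (Invertible)
import Algebra.Definitions.RawMonoid as RawMonoidDefs
open import Algebra.Structures using (IsCommutativeRing)
import Algebra.Properties.CommutativeMonoid.Sum as SumProperties
open import Data.Bool.Base using (if_then_else_)
open import Data.Fin.Base using (Fin; zero; suc)
open import Data.Fin.Properties using (_≟_)
open import Data.Nat.Base as ℕ using (ℕ; zero; suc)
open import Data.Product.Base using (Σ; ∃; _×_; _,_; proj₁; proj₂)
open import Data.Sum.Base using (_⊎_; inj₁; inj₂)
open import Data.Vec.Functional using (Vector)
open import Function.Bundles using (_⇔_)
open import Level using (Level; 0ℓ; _⊔_) renaming (suc to ℓsuc)
open import Relation.Binary.Core using (Rel)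
open import Relation.Binary.Definitions using (Decidable; Irreflexive; Symmetric)
open import Relation.Binary.PropositionalEquality.Core using (_≡_; _≢_; ≢-sym)
open import Relation.Binary.Structures using (IsStrictPartialOrder)
open import Relation.Nullary using (¬_; does; yes; no; ¬?; _×-dec_)
open import Relation.Nullary.Negation using (contradiction)

-- The order axioms are phrased so that they also hold constructively:
-- trichotomy is replaced by cotransitivity and connectedness, and only
-- elements apart from 0 are inverted. Classically this is the usual notion
-- of an ordered field.
record OrderedField (c ℓ₁ ℓ₂ : Level) : Set (ℓsuc (c ⊔ ℓ₁ ⊔ ℓ₂)) where
  infix  4 _≈_ _<_ _≤_ _#_
  infixl 7 _*_
  infixl 6 _+_
  infix  8 -_
  field
    Carrier : Set c
    _≈_     : Rel Carrier ℓ₁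
    _<_     : Rel Carrier ℓ₂
    _+_ _*_ : Op₂ Carrier
    -_      : Op₁ Carrier
    0# 1#   : Carrier

  _≤_ : Rel Carrier ℓ₂
  x ≤ y = ¬ (y < x)

  _#_ : Rel Carrier ℓ₂
  x # y = x < y ⊎ y < x

  field
    isCommutativeRing    : IsCommutativeRing _≈_ _+_ _*_ -_ 0# 1#
    isStrictPartialOrder : IsStrictPartialOrder _≈_ _<_
    <-cotransitive       : ∀ {x y} → x < y → ∀ z → x < z ⊎ z < y
    <-connected          : ∀ {x y} → x ≤ y → y ≤ x → x ≈ y
    +-monoˡ-<            : ∀ {x y} z → x < y → x + z < y + z
    *-pos                : ∀ {x y} → 0# < x → 0# < y → 0# < x * y
    0<1                  : 0# < 1#
    #0⇒invertible        : ∀ {x} → x # 0# → Invertible _≈_ 1# _*_ x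

  commutativeRing : CommutativeRing c ℓ₁
  commutativeRing = record { isCommutativeRing = isCommutativeRing }

  open CommutativeRing commutativeRing public
    hiding (Carrier; _≈_; _+_; _*_; -_; 0#; 1#; isCommutativeRing)
    renaming (zero to *-zero)
  open IsStrictPartialOrder isStrictPartialOrder public
    using (<-resp-≈; <-respˡ-≈; <-respʳ-≈)
    renaming (irrefl to <-irrefl; trans to <-trans; asym to <-asym)

  reciprocal : ∀ x → x # 0# → Carrier
  reciprocal x x#0 = proj₁ (#0⇒invertible x#0)

  fromℕ : ℕ → Carrier
  fromℕ n = n · 1#
    where open RawMonoidDefs +-rawMonoid using () renaming (_×_ to _·_)

  -- ∣ x - y ∣ < ε
  Within : (ε x y : Carrier) → Set ℓ₂
  Within ε x y = x < y + ε × y < x + ε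

  IsCauchy : (ℕ → Carrier) → Set (c ⊔ ℓ₂)
  IsCauchy f = ∀ ε → 0# < ε →
    ∃ λ N → ∀ m n → N ℕ.≤ m → N ℕ.≤ n → Within ε (f m) (f n)

  _ConvergesTo_ : (ℕ → Carrier) → Carrier → Set (c ⊔ ℓ₂)
  f ConvergesTo l = ∀ ε → 0# < ε →
    ∃ λ N → ∀ n → N ℕ.≤ n → Within ε (f n) l

-- The field of real numbers, given by its axioms. Classically, a
-- Cauchy-complete Archimedean ordered field is unique up to isomorphism.
record RealNumbers (c ℓ₁ ℓ₂ : Level) : Set (ℓsuc (c ⊔ ℓ₁ ⊔ ℓ₂)) where
  field
    orderedField : OrderedField c ℓ₁ ℓ₂

  open OrderedField orderedField public

  field
    archimedean : ∀ x → ∃ λ n → x < fromℕ n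
    complete    : ∀ f → IsCauchy f → ∃ λ l → f ConvergesTo l

record SimpleGraph (n : ℕ) : Set₁ where
  infix 4 _~_
  field
    _~_       : Rel (Fin n) 0ℓ
    adjacent? : Decidable _~_
    ~-sym     : Symmetric _~_
    ~-irrefl  : Irreflexive _≡_ _~_

complement : ∀ {n} → SimpleGraph n → SimpleGraph n
complement G = record
  { _~_       = λ i j → i ≢ j × ¬ (i ~ j)
  ; adjacent? = λ i j → ¬? (i ≟ j) ×-dec ¬? (adjacent? i j)
  ; ~-sym     = λ (i≢j , i≁j) → ≢-sym i≢j , λ j~i → i≁j (~-sym j~i)
  ; ~-irrefl  = λ i≡j (i≢j , _) → i≢j i≡j
  }
  where open SimpleGraph G

module RealMatrices {c ℓ₁ ℓ₂ : Level} (ℝ : RealNumbers c ℓ₁ ℓ₂) where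

  open RealNumbers ℝ
  open SumProperties +-commutativeMonoid using (sum)

  infix  4 _≋_
  infixl 7 _·_ _∘_

  Matrix : ℕ → Set c
  Matrix n = Vector (Vector Carrier n) n

  _≋_ : ∀ {n} → Rel (Matrix n) ℓ₁
  M ≋ N = ∀ i j → M i j ≈ N i j

  O : ∀ {n} → Matrix n
  O i j = 0#

  I : ∀ {n} → Matrix n
  I i j = if does (i ≟ j) then 1# else 0#

  J : ∀ {n} → Matrix n
  J i j = 1#

  _·_ : ∀ {n} → Matrix n → Matrix n → Matrix n
  (M · N) i j = sum (λ k → M i k * N k j)

  _∘_ : ∀ {n} → Matrix n → Matrix n → Matrix n
  (M ∘ N) i j = M i j * N i j

  tr : ∀ {n} → Matrix n → Carrier
  tr M = sum (λ i → M i i)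

  ⟨_,_⟩ : ∀ {n} → Matrix n → Matrix n → Carrier
  ⟨ M , N ⟩ = tr (M · N)

  IsSymmetric : ∀ {n} → Matrix n → Set ℓ₁
  IsSymmetric M = ∀ i j → M i j ≈ M j i

  HasZeroDiagonal : ∀ {n} → Matrix n → Set ℓ₁
  HasZeroDiagonal M = ∀ i → M i i ≈ 0#

  Nonnegative : ∀ {n} → Matrix n → Set ℓ₂
  Nonnegative M = ∀ i j → 0# ≤ M i j

  record PositiveSemidefinite {n} (M : Matrix n) : Set (c ⊔ ℓ₁ ⊔ ℓ₂) where
    field
      symmetric   : IsSymmetric M
      nonnegative : ∀ (v : Vector Carrier n) →
                    0# ≤ sum (λ i → sum (λ j → v i * M i j * v j))

  IsZeroOne : ∀ {n} → Matrix n → Set ℓ₁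
  IsZeroOne M = ∀ i j → M i j ≈ 0# ⊎ M i j ≈ 1#

  SameSupport : ∀ {n} → Matrix n → Matrix n → Set ℓ₁
  SameSupport M N = ∀ i j → M i j ≉ 0# ⇔ N i j ≉ 0#

  adjacencyMatrix : ∀ {n} → SimpleGraph n → Matrix n
  adjacencyMatrix G i j = if does (adjacent? i j) then 1# else 0#
    where open SimpleGraph G

  record Feasible {n} (G : SimpleGraph n) (Z : Matrix n) : Set (c ⊔ ℓ₁ ⊔ ℓ₂) where
    field
      symmetric    : IsSymmetric Z
      unitTrace    : ⟨ I , Z ⟩ ≈ 1#
      offEdges     : Z ∘ adjacencyMatrix (complement G) ≋ O
      nonnegative  : Nonnegative Z
      semidefinite : PositiveSemidefinite Z

  -- χ is the maximum, in particular attained, of ⟨ J , Z ⟩ over feasible Z.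
  -- It is a relation because the maximum cannot be computed from G in
  -- general; it determines χ up to _≈_. A graph on no vertices has no
  -- feasible Z, hence no vector chromatic number.
  record IsVectorChromaticNumber {n} (G : SimpleGraph n) (χ : Carrier)
         : Set (c ⊔ ℓ₁ ⊔ ℓ₂) where
    field
      attained   : Σ (Matrix n) λ Z → Feasible G Z × ⟨ J , Z ⟩ ≈ χ
      upperBound : ∀ (Z : Matrix n) → Feasible G Z → ⟨ J , Z ⟩ ≤ χ

  ≤-resp : ∀ {x x′ y y′} → x ≈ x′ → y ≈ y′ → x ≤ y → x′ ≤ y′
  ≤-resp x≈x′ y≈y′ x≤y y′<x′ =
    x≤y (<-respˡ-≈ (sym y≈y′) (<-respʳ-≈ (sym x≈x′) y′<x′))

  +-cancelʳ-< : ∀ {x y} z → x + z < y + z → x < y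
  +-cancelʳ-< {x} {y} z x+z<y+z =
    <-respˡ-≈ (cancel x) (<-respʳ-≈ (cancel y) (+-monoˡ-< (- z) x+z<y+z))
    where
    cancel : ∀ w → w + z + - z ≈ w
    cancel w = trans (+-assoc w z (- z))
                     (trans (+-congˡ (-‿inverseʳ z)) (+-identityʳ w))

  +-mono-≤ : ∀ {x y u v} → x ≤ y → u ≤ v → x + u ≤ y + v
  +-mono-≤ {x} {y} {u} {v} x≤y u≤v y+v<x+u
    with <-cotransitive y+v<x+u (x + v)
  ... | inj₁ y+v<x+v = x≤y (+-cancelʳ-< v y+v<x+v)
  ... | inj₂ x+v<x+u = u≤v (+-cancelʳ-< x
          (<-respˡ-≈ (+-comm x v) (<-respʳ-≈ (+-comm x u) x+v<x+u)))

  sum-mono-≤ : ∀ {n} {f g : Vector Carrier n} →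
               (∀ i → f i ≤ g i) → sum f ≤ sum g
  sum-mono-≤ {zero}  f≤g = <-irrefl refl
  sum-mono-≤ {suc n} f≤g =
    +-mono-≤ (f≤g zero) (sum-mono-≤ (λ i → f≤g (suc i)))

  ⟨I,Z⟩≤⟨J,Z⟩ : ∀ {n} (Z : Matrix n) → Nonnegative Z → ⟨ I , Z ⟩ ≤ ⟨ J , Z ⟩
  ⟨I,Z⟩≤⟨J,Z⟩ Z Z≥0 = sum-mono-≤ (λ i → sum-mono-≤ (λ k → entry i k))
    where
    entry : ∀ i k → I i k * Z k i ≤ J i k * Z k i
    entry i k with i ≟ k
    ... | yes _ = <-irrefl refl
    ... | no  _ = ≤-resp (sym (zeroˡ _)) (sym (*-identityˡ _)) (Z≥0 k i)

  -- This makes 1 / χ meaningful without assuming χ apart from 0.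
  module _ {n} {G : SimpleGraph n} {χ : Carrier}
           (isχ : IsVectorChromaticNumber G χ) where
    open IsVectorChromaticNumber isχ

    1≤χ : 1# ≤ χ
    1≤χ with attained
    ... | Z , feasible , ⟨J,Z⟩≈χ =
      ≤-resp unitTrace ⟨J,Z⟩≈χ (⟨I,Z⟩≤⟨J,Z⟩ Z nonnegative)
      where open Feasible feasible

    χ#0 : χ # 0#
    χ#0 with <-cotransitive 0<1 χ
    ... | inj₁ 0<χ = inj₂ 0<χ
    ... | inj₂ χ<1 = contradiction χ<1 1≤χ

{-# OPTIONS --safe #-}

-- Let W = X ∘ X, positive semidefinite by Schur's theorem. Move every entry
-- of W at a non-edge {i , j} to the diagonal, by adding the semidefinite
-- matrix W i j * (eᵢ - eⱼ)(eᵢ - eⱼ)ᵀ. The result Z is, up to scaling, feasible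
-- for χ, has the same entry sum as W, and its trace is the sum of W over the
-- pairs that are not edges. So these pairs carry at least a fraction 1 / χ of
-- ⟨ X , X ⟩, the edges at most 1 - 1 / χ, and Cauchy–Schwarz over the edges
-- finishes. Schur's theorem is proved by eliminating one row at a time, since
-- this needs neither square roots nor eigenvalues.

module Submission where

open import Defs
import Algebra.Properties.Ring as RingProperties
import Algebra.Properties.Semiring.Sum as SemiringSum
import Algebra.Solver.Ring.NaturalCoefficients.Default as RingSolver
open import Data.Fin.Base using (zero; suc)
open import Data.Fin.Properties using (_≟_)
open import Data.Nat.Base using (ℕ; zero; suc)
open import Data.Product.Base using (_,_; proj₁; proj₂)
open import Data.Sum.Base using (_⊎_; inj₁; inj₂)
open import Data.Vec.Functional using (Vector; _∷_)
open import Function.Base using (_$_)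
open import Function.Bundles using (module Equivalence)
open import Level using (Level; _⊔_)
import Relation.Binary.PropositionalEquality.Core as ≡
import Relation.Binary.Reasoning.Setoid as SetoidReasoning
open import Relation.Nullary using (¬_; yes; no)
open import Relation.Nullary.Negation using (contradiction)

module Spectral {c ℓ₁ ℓ₂ : Level} (ℝ : RealNumbers c ℓ₁ ℓ₂) where

  open RealNumbers ℝ
  open RealMatrices ℝ
  open RingProperties ring using (-‿distribˡ-*; -‿involutive)
  open RingSolver commutativeSemiring using (solve; _:+_; _:*_; _:=_)
  open SemiringSum semiring
    using (sum; sum-cong-≋; sum-replicate-zero; ∑-distrib-+; ∑-comm; *-distribˡ-sum; *-distribʳ-sum)
  open SetoidReasoning setoid

  -- Constructive arithmetic in an ordered field.

  ≤-refl : ∀ {x} → x ≤ x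
  ≤-refl = <-irrefl refl

  -- As `_≤_` is a negation, a violation `z < x` is assumed and split at `y` by cotransitivity,
  -- which stands in for trichotomy.
  ≤-trans : ∀ {x y z} → x ≤ y → y ≤ z → x ≤ z
  ≤-trans {y = y} x≤y y≤z z<x with <-cotransitive z<x y
  ... | inj₁ z<y = y≤z z<y
  ... | inj₂ y<x = x≤y y<x

  <-≤-trans : ∀ {x y z} → x < y → y ≤ z → x < z
  <-≤-trans {z = z} x<y y≤z with <-cotransitive x<y z
  ... | inj₁ x<z = x<z
  ... | inj₂ z<y = contradiction z<y y≤z

  -- `<-connected` obtains equality from two negations, so equality is stable. This matters because
  -- `SameSupport` speaks of entries only through `_≉_`.
  ≈-stable : ∀ {x y} → ¬ (x ≉ y) → x ≈ y
  ≈-stable ¬x≉y = <-connected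
    (λ y<x → ¬x≉y λ x≈y → <-irrefl (sym x≈y) y<x)
    (λ x<y → ¬x≉y λ x≈y → <-irrefl x≈y x<y)

  +-cancelʳ-≤ : ∀ {x y} z → x + z ≤ y + z → x ≤ y
  +-cancelʳ-≤ z x+z≤y+z y<x = x+z≤y+z (+-monoˡ-< z y<x)

  x≤x+y : ∀ {x y} → 0# ≤ y → x ≤ x + y
  x≤x+y 0≤y = ≤-resp (+-identityʳ _) refl (+-mono-≤ ≤-refl 0≤y)

  +-nonneg : ∀ {x y} → 0# ≤ x → 0# ≤ y → 0# ≤ x + y
  +-nonneg 0≤x 0≤y = ≤-trans 0≤x (x≤x+y 0≤y)

  x+[y-x]≈y : ∀ x y → x + (y - x) ≈ y
  x+[y-x]≈y x y = begin
    x + (y - x)   ≈⟨ solve 3 (λ x y z → x :+ (y :+ z) := y :+ (x :+ z)) refl x y (- x) ⟩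
    y + (x - x)   ≈⟨ +-congˡ (-‿inverseʳ x) ⟩
    y + 0#        ≈⟨ +-identityʳ y ⟩
    y             ∎

  -- Signs cannot be decided, so the product is assumed negative. Then `0# < x` would force
  -- `y ≈ 0#`, a contradiction; hence `x ≈ 0#`, which is a contradiction as well.
  *-nonneg : ∀ {x y} → 0# ≤ x → 0# ≤ y → 0# ≤ x * y
  *-nonneg {x} {y} 0≤x 0≤y xy<0 = <-irrefl xy≈0 xy<0
    where
    ¬0<x : ¬ 0# < x
    ¬0<x 0<x = <-irrefl (trans (*-congˡ y≈0) (zeroʳ x)) xy<0
      where
      y≈0 : y ≈ 0#
      y≈0 = <-connected (λ 0<y → <-asym xy<0 (*-pos 0<x 0<y)) 0≤y
    xy≈0 : x * y ≈ 0#
    xy≈0 = trans (*-congʳ (<-connected ¬0<x 0≤x)) (zeroˡ y)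

  -x*-x≈x*x : ∀ x → - x * - x ≈ x * x
  -x*-x≈x*x x = begin
    - x * - x     ≈⟨ -‿distribˡ-* x (- x) ⟨
    - (x * - x)   ≈⟨ -‿cong (*-comm x (- x)) ⟩
    - (- x * x)   ≈⟨ -‿cong (-‿distribˡ-* x x) ⟨
    - - (x * x)   ≈⟨ -‿involutive (x * x) ⟩
    x * x         ∎

  x<0⇒0<-x : ∀ {x} → x < 0# → 0# < - x
  x<0⇒0<-x {x} x<0 = +-cancelʳ-< x
    (<-respˡ-≈ (sym (+-identityˡ x)) (<-respʳ-≈ (sym (-‿inverseˡ x)) x<0))

  square≤0⇒≈0 : ∀ {x} → x * x ≤ 0# → x ≈ 0#
  square≤0⇒≈0 {x} x²≤0 = <-connected
    (λ 0<x → x²≤0 (*-pos 0<x 0<x))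
    (λ x<0 → x²≤0 (<-respʳ-≈ (-x*-x≈x*x x) (*-pos (x<0⇒0<-x x<0) (x<0⇒0<-x x<0))))

  square-nonneg : ∀ x → 0# ≤ x * x
  square-nonneg x x²<0 =
    <-irrefl (trans (*-congʳ (square≤0⇒≈0 (<-asym x²<0))) (zeroˡ x)) x²<0

  x≤y⇒0≤y-x : ∀ {x y} → x ≤ y → 0# ≤ y - x
  x≤y⇒0≤y-x {x} {y} x≤y = +-cancelʳ-≤ x
    (≤-resp (sym (+-identityˡ x)) (sym (trans (+-comm _ x) (x+[y-x]≈y x y))) x≤y)

  *-monoˡ-≤ : ∀ {x y} z → 0# ≤ z → x ≤ y → z * x ≤ z * y
  *-monoˡ-≤ {x} {y} z 0≤z x≤y = ≤-resp refl
    (trans (sym (distribˡ z x (y - x))) (*-congˡ (x+[y-x]≈y x y)))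
    (x≤x+y (*-nonneg 0≤z (x≤y⇒0≤y-x x≤y)))

  *-cancelˡ-≤ : ∀ {x y} z → 0# < z → z * x ≤ z * y → x ≤ y
  *-cancelˡ-≤ {x} {y} z 0<z zx≤zy y<x = zx≤zy $
    <-respˡ-≈ (+-identityˡ (z * y)) $ <-respʳ-≈ z[x-y]+zy≈zx $
    +-monoˡ-< (z * y) (*-pos 0<z 0<x-y)
    where
    0<x-y : 0# < x - y
    0<x-y = <-respˡ-≈ (-‿inverseʳ y) (+-monoˡ-< (- y) y<x)
    z[x-y]+zy≈zx : z * (x - y) + z * y ≈ z * x
    z[x-y]+zy≈zx = begin
      z * (x - y) + z * y   ≈⟨ distribˡ z (x - y) y ⟨
      z * (x - y + y)       ≈⟨ *-congˡ (trans (+-comm _ y) (x+[y-x]≈y y x)) ⟩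
      z * x                 ∎

  inverse-nonneg : ∀ {x y} → 0# < x → y * x ≈ 1# → 0# ≤ y
  inverse-nonneg {x} {y} 0<x yx≈1 = *-cancelˡ-≤ x 0<x
    (≤-resp (sym (zeroʳ x)) (trans (sym yx≈1) (*-comm y x)) (<-asym 0<1))

  2xy≤x²+y² : ∀ x y → x * y + x * y ≤ x * x + y * y
  2xy≤x²+y² x y = ≤-resp (+-identityʳ _) eq (+-mono-≤ ≤-refl (square-nonneg d))
    where
    -- The solver works over semirings, so `x` is replaced by `y + d` and the identity is checked in
    -- `y` and `d`.
    d = x - y
    y+d≈x = x+[y-x]≈y y x
    eq : x * y + x * y + d * d ≈ x * x + y * y
    eq = begin
      x * y + x * y + d * d
        ≈⟨ +-congʳ (+-cong (*-congʳ y+d≈x) (*-congʳ y+d≈x)) ⟨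
      (y + d) * y + (y + d) * y + d * d
        ≈⟨ solve 2 (λ y d → (y :+ d) :* y :+ (y :+ d) :* y :+ d :* d
                         := (y :+ d) :* (y :+ d) :+ y :* y) refl y d ⟩
      (y + d) * (y + d) + y * y
        ≈⟨ +-congʳ (*-cong y+d≈x y+d≈x) ⟩
      x * x + y * y ∎

  -- The premise is nonnegativity of the binary quadratic form with coefficients `p`, `- c`, `q`.
  -- The sign of `p` is undecidable, so `p * q < c * c` is refuted instead: it rules out positive
  -- `p` and positive `q`, after which `c * c` would be both at most zero and positive.
  discriminant : ∀ {p q c} →
    (∀ s t → s * t * c + s * t * c ≤ s * s * p + t * t * q) → c * c ≤ p * q
  discriminant {p} {q} {c} form pq<c² = c²≰0 c²≤0
    where
    swapped : ∀ s t → s * t * c + s * t * c ≤ s * s * q + t * t * p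
    swapped s t = ≤-resp
      (solve 3 (λ s t c → t :* s :* c :+ t :* s :* c := s :* t :* c :+ s :* t :* c) refl s t c)
      (+-comm _ _) (form t s)

    -- The form at (c , p), divided by p.
    ¬pos : ∀ {p q} → (∀ s t → s * t * c + s * t * c ≤ s * s * p + t * t * q) →
           p * q < c * c → p ≤ 0#
    ¬pos {p} {q} form pq<c² 0<p = *-cancelˡ-≤ p 0<p
      (+-cancelʳ-≤ (p * (c * c))
        (≤-resp
          (solve 2 (λ p c → c :* p :* c :+ c :* p :* c := p :* (c :* c) :+ p :* (c :* c)) refl p c)
          (solve 3 (λ p q c → c :* c :* p :+ p :* p :* q := p :* (p :* q) :+ p :* (c :* c)) refl p q c)
          (form c p)))
      pq<c²

    p≤0 : p ≤ 0#
    p≤0 = ¬pos form pq<c²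

    q≤0 : q ≤ 0#
    q≤0 = ¬pos swapped (<-respˡ-≈ (*-comm p q) pq<c²)

    -- The form at (1 , c).
    c²≤0 : c * c ≤ 0#
    c²≤0 = ≤-trans (x≤x+y (square-nonneg c)) $ ≤-trans
      (≤-resp (+-cong (*-congʳ (*-identityˡ c)) (*-congʳ (*-identityˡ c))) refl (form 1# c))
      (≤-resp refl (trans (+-cong (zeroʳ _) (zeroʳ _)) (+-identityʳ 0#))
        (+-mono-≤ (*-monoˡ-≤ _ (square-nonneg 1#) p≤0) (*-monoˡ-≤ _ (square-nonneg c) q≤0)))

    -- The form at (1 , 0).
    0≤p : 0# ≤ p
    0≤p = ≤-resp
      (trans (+-cong s0c≈0 s0c≈0) (+-identityʳ 0#))
      (trans (+-cong (trans (*-congʳ (*-identityˡ 1#)) (*-identityˡ p))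
                     (trans (*-congʳ (zeroˡ 0#)) (zeroˡ q)))
             (+-identityʳ p))
      (form 1# 0#)
      where
      s0c≈0 : 1# * 0# * c ≈ 0#
      s0c≈0 = trans (*-congʳ (zeroʳ 1#)) (zeroˡ c)

    c²≰0 : ¬ (c * c ≤ 0#)
    c²≰0 c²≤0 = c²≤0
      (<-respˡ-≈ (trans (*-congʳ (<-connected p≤0 0≤p)) (zeroˡ q)) pq<c²)

  -- Sums over matrix entries and the Cauchy-Schwarz inequality.

  -- `⟨ M , N ⟩` unfolds to `sum² (λ i k → M i k * N k i)`, so it equals `sum² (M ∘ N)` once `N` is
  -- symmetric.
  sum² : ∀ {n} → Matrix n → Carrier
  sum² M = sum (λ i → sum (M i))

  sum²-cong : ∀ {n} {M N : Matrix n} → M ≋ N → sum² M ≈ sum² N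
  sum²-cong M≋N = sum-cong-≋ (λ i → sum-cong-≋ (M≋N i))

  sum²-distrib-+ : ∀ {n} (M N : Matrix n) →
                   sum² (λ i j → M i j + N i j) ≈ sum² M + sum² N
  sum²-distrib-+ M N = trans (sum-cong-≋ (λ i → ∑-distrib-+ (M i) (N i)))
                             (∑-distrib-+ (λ i → sum (M i)) (λ i → sum (N i)))

  *-distribˡ-sum² : ∀ {n} x (M : Matrix n) → x * sum² M ≈ sum² (λ i j → x * M i j)
  *-distribˡ-sum² x M = trans (*-distribˡ-sum x (λ i → sum (M i)))
                              (sum-cong-≋ (λ i → *-distribˡ-sum x (M i)))

  sum²-mono-≤ : ∀ {n} {M N : Matrix n} → (∀ i j → M i j ≤ N i j) → sum² M ≤ sum² N
  sum²-mono-≤ M≤N = sum-mono-≤ (λ i → sum-mono-≤ (M≤N i))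

  sum-nonneg : ∀ {n} {v : Vector Carrier n} → (∀ i → 0# ≤ v i) → 0# ≤ sum v
  sum-nonneg {n} 0≤v = ≤-resp (sum-replicate-zero n) refl (sum-mono-≤ 0≤v)

  sum²-nonneg : ∀ {n} {M : Matrix n} → Nonnegative M → 0# ≤ sum² M
  sum²-nonneg 0≤M = sum-nonneg (λ i → sum-nonneg (0≤M i))

  sum²-product : ∀ {n} (v w : Vector Carrier n) →
                 sum² (λ i j → v i * w j) ≈ sum v * sum w
  sum²-product v w = trans
    (sum-cong-≋ (λ i → sym (*-distribˡ-sum (v i) w)))
    (sym (*-distribʳ-sum (sum w) v))

  minor : ∀ {n} → Matrix (suc n) → Matrix n
  minor M i j = M (suc i) (suc j)

  sum²-cons : ∀ {n} (M : Matrix (suc n)) → IsSymmetric M →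
    sum² M ≈ M zero zero
             + (sum (λ j → M zero (suc j)) + sum (λ j → M zero (suc j)))
             + sum² (minor M)
  sum²-cons M M-sym = begin
    M zero zero + e + sum (λ i → M (suc i) zero + sum (λ j → M (suc i) (suc j)))
      ≈⟨ +-congˡ (∑-distrib-+ (λ i → M (suc i) zero) (λ i → sum (minor M i))) ⟩
    M zero zero + e + (sum (λ i → M (suc i) zero) + sum² (minor M))
      ≈⟨ +-congˡ (+-congʳ (sum-cong-≋ (λ i → M-sym (suc i) zero))) ⟩
    M zero zero + e + (e + sum² (minor M))
      ≈⟨ solve 3 (λ a e s → a :+ e :+ (e :+ s) := a :+ (e :+ e) :+ s) refl _ e _ ⟩
    M zero zero + (e + e) + sum² (minor M) ∎
    where
    e = sum (λ j → M zero (suc j))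

  -- Applying `2xy≤x²+y²` to `s * M i j` and `t * N i j` and summing over all entries gives the
  -- binary form that `discriminant` asks for.
  cauchySchwarz : ∀ {n} (M N : Matrix n) →
                  sum² (M ∘ N) * sum² (M ∘ N) ≤ sum² (M ∘ M) * sum² (N ∘ N)
  cauchySchwarz M N = discriminant λ s t →
    ≤-resp
      (trans (sum²-distrib-+ (scaled (s * t) M N) (scaled (s * t) M N))
             (+-cong (scale (s * t) M N) (scale (s * t) M N)))
      (trans (sum²-distrib-+ (scaled (s * s) M M) (scaled (t * t) N N))
             (+-cong (scale (s * s) M M) (scale (t * t) N N)))
      (sum²-mono-≤ λ i j → ≤-resp
        (solve 4 (λ s t x y → s :* x :* (t :* y) :+ s :* x :* (t :* y)
                           := s :* t :* (x :* y) :+ s :* t :* (x :* y)) refl s t (M i j) (N i j))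
        (solve 4 (λ s t x y → s :* x :* (s :* x) :+ t :* y :* (t :* y)
                           := s :* s :* (x :* x) :+ t :* t :* (y :* y)) refl s t (M i j) (N i j))
        (2xy≤x²+y² (s * M i j) (t * N i j)))
    where
    scaled : ∀ {n} → Carrier → Matrix n → Matrix n → Matrix n
    scaled x M N i j = x * (M ∘ N) i j
    scale : ∀ {n} x (M N : Matrix n) → sum² (scaled x M N) ≈ x * sum² (M ∘ N)
    scale x M N = sym (*-distribˡ-sum² x (M ∘ N))

  -- Quadratic forms and Schur complements.

  quad : ∀ {n} → Matrix n → Vector Carrier n → Carrier
  quad M v = sum² (λ i j → v i * M i j * v j)

  -- For symmetric `M`, half the coefficient of `x` in `quad M (x ∷ v)` read as a polynomial in `x`.
  offDiagonal : ∀ {n} → Matrix (suc n) → Vector Carrier n → Carrier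
  offDiagonal M v = sum (λ j → M zero (suc j) * v j)

  quad-cons : ∀ {n} (M : Matrix (suc n)) → IsSymmetric M → ∀ x v →
    quad M (x ∷ v) ≈ x * x * M zero zero
                     + (x * offDiagonal M v + x * offDiagonal M v)
                     + quad (minor M) v
  quad-cons M M-sym x v = trans (sum²-cons N N-sym)
    (+-congʳ (+-cong
      (solve 2 (λ x a → x :* a :* x := x :* x :* a) refl x (M zero zero))
      (+-cong row row)))
    where
    w = x ∷ v
    N : Matrix _
    N i j = w i * M i j * w j
    N-sym : IsSymmetric N
    N-sym i j = trans (*-congʳ (*-congˡ (M-sym i j)))
      (solve 3 (λ x a y → x :* a :* y := y :* a :* x) refl (w i) (M j i) (w j))
    row : sum (λ j → x * M zero (suc j) * v j) ≈ x * offDiagonal M v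
    row = trans (sum-cong-≋ (λ j → *-assoc x _ (v j)))
                (sym (*-distribˡ-sum x (λ j → M zero (suc j) * v j)))

  module _ {n} {A : Matrix (suc n)} (A⪰0 : PositiveSemidefinite A) where
    open PositiveSemidefinite A⪰0

    minor-semidefinite : PositiveSemidefinite (minor A)
    minor-semidefinite = record
      { symmetric   = λ i j → symmetric (suc i) (suc j)
      ; nonnegative = λ v → ≤-resp refl (trans (quad-cons A symmetric 0# v) (0-terms v))
                              (nonnegative (0# ∷ v))
      }
      where
      0-terms : ∀ v → 0# * 0# * A zero zero
                      + (0# * offDiagonal A v + 0# * offDiagonal A v)
                      + quad (minor A) v ≈ quad (minor A) v
      0-terms v = begin
        0# * 0# * a + (0# * d + 0# * d) + q
          ≈⟨ +-congʳ (+-cong (trans (*-congʳ (zeroˡ 0#)) (zeroˡ a)) (+-cong (zeroˡ d) (zeroˡ d))) ⟩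
        0# + (0# + 0#) + q
          ≈⟨ +-congʳ (trans (+-identityˡ _) (+-identityˡ 0#)) ⟩
        0# + q
          ≈⟨ +-identityˡ q ⟩
        q ∎
        where
        a = A zero zero
        d = offDiagonal A v
        q = quad (minor A) v

    -- On vectors with first coordinate `- s` and tail `t` times `v`, the form of `A` is a binary
    -- form in `s` and `t`. The minus sign makes the cross terms negative, so that they land on the
    -- left as `discriminant` expects.
    offDiagonal-discriminant : ∀ v →
      offDiagonal A v * offDiagonal A v ≤ A zero zero * quad (minor A) v
    offDiagonal-discriminant v = discriminant λ s t →
      ≤-resp (+-identityˡ _) (expand s t)
        (+-mono-≤ (nonnegative (- s ∷ λ i → t * v i)) ≤-refl)
      where
      a = A zero zero
      d = offDiagonal A v
      q = quad (minor A) v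
      expand : ∀ s t → quad A (- s ∷ λ i → t * v i) + (s * t * d + s * t * d)
                       ≈ s * s * a + t * t * q
      expand s t = begin
        quad A (r ∷ λ i → t * v i) + (s * t * d + s * t * d)
          ≈⟨ +-congʳ (trans (quad-cons A symmetric r _)
               (+-cong (+-congˡ (+-cong (*-congˡ d-scale) (*-congˡ d-scale))) q-scale)) ⟩
        r * r * a + (r * (t * d) + r * (t * d)) + t * t * q + (s * t * d + s * t * d)
          ≈⟨ solve 6 (λ r s t a d q →
               r :* r :* a :+ (r :* (t :* d) :+ r :* (t :* d)) :+ t :* t :* q
                 :+ (s :* t :* d :+ s :* t :* d)
               := r :* r :* a :+ t :* t :* q :+ (r :+ s) :* (t :* d :+ t :* d))
               refl r s t a d q ⟩
        r * r * a + t * t * q + (r + s) * (t * d + t * d)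
          ≈⟨ +-cong (+-congʳ (*-congʳ (-x*-x≈x*x s)))
               (trans (*-congʳ (-‿inverseˡ s)) (zeroˡ _)) ⟩
        s * s * a + t * t * q + 0#
          ≈⟨ +-identityʳ _ ⟩
        s * s * a + t * t * q ∎
        where
        -- An independent variable for the solver; afterwards `r + s` vanishes and `r * r` becomes
        -- `s * s`.
        r = - s
        d-scale : offDiagonal A (λ i → t * v i) ≈ t * d
        d-scale = trans
          (sum-cong-≋ λ j → solve 3 (λ u t v → u :* (t :* v) := t :* (u :* v))
                                    refl (A zero (suc j)) t (v j))
          (sym (*-distribˡ-sum t (λ j → A zero (suc j) * v j)))
        q-scale : quad (minor A) (λ i → t * v i) ≈ t * t * q
        q-scale = trans
          (sum²-cong λ i j → solve 4 (λ t v a w → t :* v :* a :* (t :* w) := t :* t :* (v :* a :* w))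
                                     refl t (v i) (minor A i j) (v j))
          (sym (*-distribˡ-sum² (t * t) (λ i j → v i * minor A i j * v j)))

    corner-nonneg : 0# ≤ A zero zero
    corner-nonneg = ≤-resp refl value (nonnegative (1# ∷ λ _ → 0#))
      where
      d≈0 : offDiagonal A (λ _ → 0#) ≈ 0#
      d≈0 = trans (sum-cong-≋ (λ j → zeroʳ (A zero (suc j)))) (sum-replicate-zero n)
      q≈0 : quad (minor A) (λ _ → 0#) ≈ 0#
      q≈0 = trans
        (sum-cong-≋ (λ i → trans (sum-cong-≋ (λ j → zeroʳ (0# * minor A i j))) (sum-replicate-zero n)))
        (sum-replicate-zero n)
      value : quad A (1# ∷ λ _ → 0#) ≈ A zero zero
      value = begin
        quad A (1# ∷ λ _ → 0#)
          ≈⟨ quad-cons A symmetric 1# (λ _ → 0#) ⟩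
        1# * 1# * a + (1# * d + 1# * d) + q
          ≈⟨ +-cong (+-cong (*-congʳ (*-identityˡ 1#))
                            (+-cong (trans (*-identityˡ d) d≈0) (trans (*-identityˡ d) d≈0))) q≈0 ⟩
        1# * a + (0# + 0#) + 0#
          ≈⟨ trans (+-identityʳ _) (+-cong (*-identityˡ a) (+-identityʳ 0#)) ⟩
        a + 0#
          ≈⟨ +-identityʳ a ⟩
        a ∎
        where
        a = A zero zero
        d = offDiagonal A (λ _ → 0#)
        q = quad (minor A) (λ _ → 0#)

  -- a (M / a), where M / a is the Schur complement of the corner entry a.
  schurComplement : ∀ {n} → Matrix (suc n) → Matrix n
  schurComplement A i j = A zero zero * A (suc i) (suc j) - A zero (suc i) * A zero (suc j)

  schurComplement-+ : ∀ {n} (A : Matrix (suc n)) i j →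
    A zero (suc i) * A zero (suc j) + schurComplement A i j ≈ A zero zero * minor A i j
  schurComplement-+ A i j = x+[y-x]≈y _ _

  -- Its form at `v` is `a * quad (minor A) v` less the square of `offDiagonal A v`, and
  -- `offDiagonal-discriminant` bounds that square. The factor `a` spares a division by the corner,
  -- which may vanish.
  schurComplement-semidefinite : ∀ {n} {A : Matrix (suc n)} →
    PositiveSemidefinite A → PositiveSemidefinite (schurComplement A)
  schurComplement-semidefinite {A = A} A⪰0 = record
    { symmetric   = λ i j → +-cong (*-congˡ (symmetric (suc i) (suc j)))
                                   (-‿cong (*-comm _ _))
    ; nonnegative = λ v → +-cancelʳ-≤ (offDiagonal A v * offDiagonal A v)
        (≤-resp (sym (+-identityˡ _)) (expand v) (offDiagonal-discriminant A⪰0 v))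
    }
    where
    open PositiveSemidefinite A⪰0
    a = A zero zero
    S = schurComplement A
    expand : ∀ v → a * quad (minor A) v ≈ quad S v + offDiagonal A v * offDiagonal A v
    expand v = begin
      a * quad (minor A) v
        ≈⟨ *-distribˡ-sum² a (λ i j → v i * minor A i j * v j) ⟩
      sum² (λ i j → a * (v i * minor A i j * v j))
        ≈⟨ sum²-cong pointwise ⟩
      sum² (λ i j → v i * S i j * v j + A zero (suc i) * v i * (A zero (suc j) * v j))
        ≈⟨ sum²-distrib-+ (λ i j → v i * S i j * v j) (λ i j → uv i * uv j) ⟩
      quad S v + sum² (λ i j → A zero (suc i) * v i * (A zero (suc j) * v j))
        ≈⟨ +-congˡ (sum²-product uv uv) ⟩
      quad S v + offDiagonal A v * offDiagonal A v ∎
      where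
      uv : Vector Carrier _
      uv i = A zero (suc i) * v i
      pointwise : ∀ i j → a * (v i * minor A i j * v j)
        ≈ v i * S i j * v j + A zero (suc i) * v i * (A zero (suc j) * v j)
      pointwise i j = begin
        a * (v i * minor A i j * v j)
          ≈⟨ solve 4 (λ a x m y → a :* (x :* m :* y) := x :* (a :* m) :* y) refl a (v i) _ (v j) ⟩
        v i * (a * minor A i j) * v j
          ≈⟨ *-congʳ (*-congˡ (schurComplement-+ A i j)) ⟨
        v i * (A zero (suc i) * A zero (suc j) + S i j) * v j
          ≈⟨ solve 5 (λ x y p q s → x :* (p :* q :+ s) :* y := x :* s :* y :+ p :* x :* (q :* y))
               refl (v i) (v j) _ _ _ ⟩
        v i * S i j * v j + A zero (suc i) * v i * (A zero (suc j) * v j) ∎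

  -- Schur's product theorem.

  -- Induction on the size. A positive corner `a` lets the first row of `A` be eliminated, leaving
  -- the Schur complement; a zero corner leaves the minors. These cases cannot be told apart, so the
  -- sum is assumed negative: this refutes `0# < a`, hence `a ≈ 0#`, and the second case contradicts
  -- the assumption.
  semidefinite-pairing-nonneg : ∀ {n} {A B : Matrix n} →
    PositiveSemidefinite A → PositiveSemidefinite B → 0# ≤ sum² (A ∘ B)
  semidefinite-pairing-nonneg {zero}          A⪰0 B⪰0 = ≤-refl
  semidefinite-pairing-nonneg {suc n} {A} {B} A⪰0 B⪰0 AB<0 =
    singular (<-connected ¬0<a (corner-nonneg A⪰0)) AB<0
    where
    module A = PositiveSemidefinite A⪰0
    module B = PositiveSemidefinite B⪰0
    a = A zero zero
    b = B zero zero
    u β : Vector Carrier n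
    u j = A zero (suc j)
    β j = B zero (suc j)
    d = offDiagonal A β

    AB-cons : sum² (A ∘ B) ≈ a * b + (d + d) + sum² (minor A ∘ minor B)
    AB-cons = sum²-cons (A ∘ B) (λ i j → *-cong (A.symmetric i j) (B.symmetric i j))

    -- `a` times `A` is the rank one matrix of its first row `a ∷ u` plus the Schur complement
    -- padded with zeros. Pairing the rank one matrix with `B` evaluates the form of `B` at that
    -- row.
    scaled : a * sum² (A ∘ B) ≈ quad B (a ∷ u) + sum² (schurComplement A ∘ minor B)
    scaled = begin
      a * sum² (A ∘ B)
        ≈⟨ *-congˡ AB-cons ⟩
      a * (a * b + (d + d) + sum² (minor A ∘ minor B))
        ≈⟨ solve 4 (λ a b d s → a :* (a :* b :+ (d :+ d) :+ s)
                             := a :* a :* b :+ (a :* d :+ a :* d) :+ a :* s) refl a b d _ ⟩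
      a * a * b + (a * d + a * d) + a * sum² (minor A ∘ minor B)
        ≈⟨ +-cong (+-congˡ (+-cong (*-congˡ d≈d′) (*-congˡ d≈d′)))
             (trans (*-distribˡ-sum² a (minor A ∘ minor B)) (trans (sum²-cong pointwise)
               (sum²-distrib-+ (λ i j → u i * minor B i j * u j) (schurComplement A ∘ minor B)))) ⟩
      a * a * b + (a * d′ + a * d′) + (quad (minor B) u + sum² (schurComplement A ∘ minor B))
        ≈⟨ +-assoc _ _ _ ⟨
      a * a * b + (a * d′ + a * d′) + quad (minor B) u + sum² (schurComplement A ∘ minor B)
        ≈⟨ +-congʳ (quad-cons B B.symmetric a u) ⟨
      quad B (a ∷ u) + sum² (schurComplement A ∘ minor B) ∎
      where
      d′ = offDiagonal B u
      d≈d′ : d ≈ d′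
      d≈d′ = sum-cong-≋ (λ j → *-comm (u j) (β j))
      pointwise : ∀ i j → a * (minor A i j * minor B i j)
        ≈ u i * minor B i j * u j + schurComplement A i j * minor B i j
      pointwise i j = begin
        a * (minor A i j * minor B i j)
          ≈⟨ *-assoc a _ _ ⟨
        a * minor A i j * minor B i j
          ≈⟨ *-congʳ (schurComplement-+ A i j) ⟨
        (u i * u j + schurComplement A i j) * minor B i j
          ≈⟨ solve 4 (λ p q s m → (p :* q :+ s) :* m := p :* m :* q :+ s :* m)
               refl (u i) (u j) (schurComplement A i j) (minor B i j) ⟩
        u i * minor B i j * u j + schurComplement A i j * minor B i j ∎

    ¬0<a : a ≤ 0#
    ¬0<a 0<a = *-cancelˡ-≤ a 0<a
      (≤-resp (sym (zeroʳ a)) (sym scaled)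
        (+-nonneg (B.nonnegative (a ∷ u))
          (semidefinite-pairing-nonneg (schurComplement-semidefinite A⪰0) (minor-semidefinite B⪰0))))
      AB<0

    singular : a ≈ 0# → 0# ≤ sum² (A ∘ B)
    singular a≈0 = ≤-resp refl (sym AB≈minors)
      (semidefinite-pairing-nonneg (minor-semidefinite A⪰0) (minor-semidefinite B⪰0))
      where
      -- A zero corner makes the rest of the first row orthogonal to every vector, here to `β`.
      d≈0 : d ≈ 0#
      d≈0 = square≤0⇒≈0 (≤-resp refl (trans (*-congʳ a≈0) (zeroˡ _)) (offDiagonal-discriminant A⪰0 β))
      AB≈minors : sum² (A ∘ B) ≈ sum² (minor A ∘ minor B)
      AB≈minors = begin
        sum² (A ∘ B)
          ≈⟨ AB-cons ⟩
        a * b + (d + d) + sum² (minor A ∘ minor B)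
          ≈⟨ +-congʳ (+-cong (trans (*-congʳ a≈0) (zeroˡ b)) (+-cong d≈0 d≈0)) ⟩
        0# + (0# + 0#) + sum² (minor A ∘ minor B)
          ≈⟨ +-congʳ (trans (+-identityˡ _) (+-identityˡ 0#)) ⟩
        0# + sum² (minor A ∘ minor B)
          ≈⟨ +-identityˡ _ ⟩
        sum² (minor A ∘ minor B) ∎

  -- The matrix is `D · A · D` for the diagonal matrix `D` with entries `v`, so its form at `w` is
  -- that of `A` at the entrywise product of `w` and `v`.
  congruence-semidefinite : ∀ {n} {A : Matrix n} (v : Vector Carrier n) →
    PositiveSemidefinite A → PositiveSemidefinite (λ i j → v i * A i j * v j)
  congruence-semidefinite {A = A} v A⪰0 = record
    { symmetric   = λ i j → trans (*-congʳ (*-congˡ (symmetric i j)))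
        (solve 3 (λ x a y → x :* a :* y := y :* a :* x) refl (v i) (A j i) (v j))
    ; nonnegative = λ w → ≤-resp refl
        (sum²-cong λ i j →
          solve 5 (λ x y a p q → p :* x :* a :* (q :* y) := p :* (x :* a :* y) :* q)
            refl (v i) (v j) (A i j) (w i) (w j))
        (nonnegative (λ i → w i * v i))
    }
    where
    open PositiveSemidefinite A⪰0

  -- The form of `A ∘ B` at `v` is the entrywise pairing of `A` with the congruence of `B` by `v`.
  schurProduct : ∀ {n} {A B : Matrix n} →
    PositiveSemidefinite A → PositiveSemidefinite B → PositiveSemidefinite (A ∘ B)
  schurProduct {A = A} {B} A⪰0 B⪰0 = record
    { symmetric   = λ i j → *-cong (A.symmetric i j) (B.symmetric i j)
    ; nonnegative = λ v → ≤-resp refl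
        (sum²-cong λ i j →
          solve 4 (λ x a b y → a :* (x :* b :* y) := x :* (a :* b) :* y)
            refl (v i) (A i j) (B i j) (v j))
        (semidefinite-pairing-nonneg A⪰0 (congruence-semidefinite v B⪰0))
    }
    where
    module A = PositiveSemidefinite A⪰0
    module B = PositiveSemidefinite B⪰0

  -- Zero-one matrices: the identity and the adjacency matrices.

  x+x≤y+y⇒x≤y : ∀ {x y} → x + x ≤ y + y → x ≤ y
  x+x≤y+y⇒x≤y {x} {y} 2x≤2y y<x = 2x≤2y
    (<-trans (+-monoˡ-< y y<x) (<-respˡ-≈ (+-comm y x) (+-monoˡ-< x y<x)))

  zeroOne-nonneg : ∀ {x} → x ≈ 0# ⊎ x ≈ 1# → 0# ≤ x
  zeroOne-nonneg (inj₁ x≈0) = ≤-resp refl (sym x≈0) ≤-refl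
  zeroOne-nonneg (inj₂ x≈1) = ≤-resp refl (sym x≈1) (<-asym 0<1)

  zeroOne-idem : ∀ {x} → x ≈ 0# ⊎ x ≈ 1# → x * x ≈ x
  zeroOne-idem (inj₁ x≈0) = trans (*-congʳ x≈0) (trans (zeroˡ _) (sym x≈0))
  zeroOne-idem (inj₂ x≈1) = trans (*-congʳ x≈1) (*-identityˡ _)

  I-zeroOne : ∀ {n} → IsZeroOne (I {n})
  I-zeroOne i j with i ≟ j
  ... | yes _ = inj₂ refl
  ... | no  _ = inj₁ refl

  -- Symmetry of the diagonal matrix with entries `v`, for the encoding `I i j * v i`.
  I-balance : ∀ {n} (v : Vector Carrier n) i j → I i j * v i ≈ I j i * v j
  I-balance v i j with i ≟ j | j ≟ i
  ... | yes ≡.refl | yes _   = refl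
  ... | yes i≡j    | no  j≢i = contradiction (≡.sym i≡j) j≢i
  ... | no  i≢j    | yes j≡i = contradiction (≡.sym j≡i) i≢j
  ... | no  _      | no  _   = trans (zeroˡ _) (sym (zeroˡ _))

  I-sift : ∀ {n} (v : Vector Carrier n) i → sum (λ k → I i k * v k) ≈ v i
  I-sift {suc n} v zero = begin
    1# * v zero + sum (λ k → 0# * v (suc k))
      ≈⟨ +-cong (*-identityˡ _) (trans (sum-cong-≋ (λ k → zeroˡ (v (suc k)))) (sum-replicate-zero n)) ⟩
    v zero + 0#
      ≈⟨ +-identityʳ _ ⟩
    v zero ∎
  -- `I (suc i) (suc k)` reduces to `I i k`, so the tail is an instance of the induction hypothesis.
  I-sift v (suc i) = begin
    0# * v zero + sum (λ k → I i k * v (suc k))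
      ≈⟨ +-cong (zeroˡ _) (I-sift (λ k → v (suc k)) i) ⟩
    0# + v (suc i)
      ≈⟨ +-identityˡ _ ⟩
    v (suc i) ∎

  module _ {n} (G : SimpleGraph n) where
    open SimpleGraph G

    adjacencyMatrix-zeroOne : IsZeroOne (adjacencyMatrix G)
    adjacencyMatrix-zeroOne i j with adjacent? i j
    ... | yes _ = inj₂ refl
    ... | no  _ = inj₁ refl

    adjacencyMatrix-symmetric : IsSymmetric (adjacencyMatrix G)
    adjacencyMatrix-symmetric i j with adjacent? i j | adjacent? j i
    ... | yes _   | yes _   = refl
    ... | yes i~j | no  j≁i = contradiction (~-sym i~j) j≁i
    ... | no  i≁j | yes j~i = contradiction (~-sym j~i) i≁j
    ... | no  _   | no  _   = refl

    I∘adjacency≋O : I ∘ adjacencyMatrix G ≋ O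
    I∘adjacency≋O i j with i ≟ j | adjacent? i j
    ... | yes i≡j | yes i~j = contradiction i~j (~-irrefl i≡j)
    ... | yes _   | no  _   = zeroʳ 1#
    ... | no  _   | yes _   = zeroˡ 1#
    ... | no  _   | no  _   = zeroˡ 0#

    adjacency∘complement≋O : adjacencyMatrix G ∘ adjacencyMatrix (complement G) ≋ O
    adjacency∘complement≋O i j with i ≟ j | adjacent? i j
    ... | yes _ | yes _ = zeroʳ 1#
    ... | yes _ | no  _ = zeroˡ 0#
    ... | no  _ | yes _ = zeroʳ 1#
    ... | no  _ | no  _ = zeroˡ 1#

    I+adjacency+complement≋J : ∀ i j →
      I i j + adjacencyMatrix G i j + adjacencyMatrix (complement G) i j ≈ 1#
    I+adjacency+complement≋J i j with i ≟ j | adjacent? i j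
    ... | yes i≡j | yes i~j = contradiction i~j (~-irrefl i≡j)
    ... | yes _   | no  _   = trans (+-identityʳ _) (+-identityʳ 1#)
    ... | no  _   | yes _   = trans (+-identityʳ _) (+-identityˡ 1#)
    ... | no  _   | no  _   = trans (+-congʳ (+-identityˡ 0#)) (+-identityˡ 1#)

  -- The cone spanned by the feasible matrices.

  -- Feasible without the normalisation of the trace.
  record InCone {n} (G : SimpleGraph n) (Z : Matrix n) : Set (c ⊔ ℓ₁ ⊔ ℓ₂) where
    field
      offEdges     : Z ∘ adjacencyMatrix (complement G) ≋ O
      nonnegative  : Nonnegative Z
      semidefinite : PositiveSemidefinite Z
    open PositiveSemidefinite semidefinite public using (symmetric)

  ⟨,⟩-scaledSum : ∀ {n} (M Z Z′ : Matrix n) τ →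
    ⟨ M , (λ i j → τ * (Z i j + Z′ i j)) ⟩ ≈ τ * (⟨ M , Z ⟩ + ⟨ M , Z′ ⟩)
  ⟨,⟩-scaledSum M Z Z′ τ = begin
    sum² (λ i k → M i k * (τ * (Z k i + Z′ k i)))
      ≈⟨ sum²-cong (λ i k → solve 4 (λ m t x y → m :* (t :* (x :+ y)) := t :* (m :* x :+ m :* y))
           refl (M i k) τ (Z k i) (Z′ k i)) ⟩
    sum² (λ i k → τ * (M i k * Z k i + M i k * Z′ k i))
      ≈⟨ *-distribˡ-sum² τ (λ i k → M i k * Z k i + M i k * Z′ k i) ⟨
    τ * sum² (λ i k → M i k * Z k i + M i k * Z′ k i)
      ≈⟨ *-congˡ (sum²-distrib-+ (λ i k → M i k * Z k i) (λ i k → M i k * Z′ k i)) ⟩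
    τ * (⟨ M , Z ⟩ + ⟨ M , Z′ ⟩) ∎

  scaledSum-semidefinite : ∀ {n} {Z Z′ : Matrix n} {τ} → 0# ≤ τ →
    PositiveSemidefinite Z → PositiveSemidefinite Z′ →
    PositiveSemidefinite (λ i j → τ * (Z i j + Z′ i j))
  scaledSum-semidefinite {Z = Z} {Z′} {τ} 0≤τ Z⪰0 Z′⪰0 = record
    { symmetric   = λ i j → *-congˡ (+-cong (Z.symmetric i j) (Z′.symmetric i j))
    ; nonnegative = λ v → ≤-resp refl (sym (expand v))
        (*-nonneg 0≤τ (+-nonneg (Z.nonnegative v) (Z′.nonnegative v)))
    }
    where
    module Z  = PositiveSemidefinite Z⪰0
    module Z′ = PositiveSemidefinite Z′⪰0
    expand : ∀ v → quad (λ i j → τ * (Z i j + Z′ i j)) v ≈ τ * (quad Z v + quad Z′ v)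
    expand v = begin
      sum² (λ i j → v i * (τ * (Z i j + Z′ i j)) * v j)
        ≈⟨ sum²-cong (λ i j → solve 5 (λ p t x y q →
             p :* (t :* (x :+ y)) :* q := t :* (p :* x :* q :+ p :* y :* q))
             refl (v i) τ (Z i j) (Z′ i j) (v j)) ⟩
      sum² (λ i j → τ * (v i * Z i j * v j + v i * Z′ i j * v j))
        ≈⟨ *-distribˡ-sum² τ (λ i j → v i * Z i j * v j + v i * Z′ i j * v j) ⟨
      τ * sum² (λ i j → v i * Z i j * v j + v i * Z′ i j * v j)
        ≈⟨ *-congˡ (sum²-distrib-+ (λ i j → v i * Z i j * v j) (λ i j → v i * Z′ i j * v j)) ⟩
      τ * (quad Z v + quad Z′ v) ∎

  -- Adding an optimal Z₀ before normalising makes the trace nonzero.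
  cone-bound : ∀ {n} {G : SimpleGraph n} {χ} → IsVectorChromaticNumber G χ →
               ∀ {Z} → InCone G Z → ⟨ J , Z ⟩ ≤ χ * ⟨ I , Z ⟩
  cone-bound {n} {G} {χ} isχ {Z} Z∈cone with IsVectorChromaticNumber.attained isχ
  -- The bound on `⟨ J , Z₁ ⟩` is multiplied by `t + 1#`; the summand `χ` contributed by `Z₀` then
  -- cancels.
  ... | Z₀ , Z₀-feasible , ⟨J,Z₀⟩≈χ = +-cancelʳ-≤ χ
    (≤-resp bound-left bound-right (*-monoˡ-≤ (t + 1#) (<-asym 0<t+1) (upperBound Z₁ Z₁-feasible)))
    where
    open IsVectorChromaticNumber isχ using (upperBound)
    module Z  = InCone Z∈cone
    module Z₀ = Feasible Z₀-feasible

    t = ⟨ I , Z ⟩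

    0≤t : 0# ≤ t
    0≤t = sum²-nonneg (λ i k → *-nonneg (zeroOne-nonneg (I-zeroOne i k)) (Z.nonnegative k i))

    0<t+1 : 0# < t + 1#
    0<t+1 = <-≤-trans 0<1 (≤-resp refl (+-comm 1# t) (x≤x+y 0≤t))

    τ = reciprocal (t + 1#) (inj₂ 0<t+1)

    τ[t+1]≈1 : τ * (t + 1#) ≈ 1#
    τ[t+1]≈1 = proj₁ (proj₂ (#0⇒invertible (inj₂ 0<t+1)))

    0≤τ : 0# ≤ τ
    0≤τ = inverse-nonneg 0<t+1 τ[t+1]≈1

    -- `Z₀` has trace one, so `Z` plus `Z₀` has trace `t + 1#`, and `τ` normalises it.
    Z₁ : Matrix n
    Z₁ i j = τ * (Z i j + Z₀ i j)

    Z₁-semidefinite : PositiveSemidefinite Z₁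
    Z₁-semidefinite = scaledSum-semidefinite 0≤τ Z.semidefinite Z₀.semidefinite

    Z₁-feasible : Feasible G Z₁
    Z₁-feasible = record
      { symmetric    = PositiveSemidefinite.symmetric Z₁-semidefinite
      ; unitTrace    = trans (⟨,⟩-scaledSum I Z Z₀ τ)
                             (trans (*-congˡ (+-congˡ Z₀.unitTrace)) τ[t+1]≈1)
      ; offEdges     = λ i j → begin
          τ * (Z i j + Z₀ i j) * adjacencyMatrix (complement G) i j
            ≈⟨ solve 4 (λ t x y a → t :* (x :+ y) :* a := t :* (x :* a :+ y :* a)) refl τ _ _ _ ⟩
          τ * ((Z ∘ adjacencyMatrix (complement G)) i j + (Z₀ ∘ adjacencyMatrix (complement G)) i j)
            ≈⟨ *-congˡ (trans (+-cong (Z.offEdges i j) (Z₀.offEdges i j)) (+-identityʳ 0#)) ⟩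
          τ * 0#
            ≈⟨ zeroʳ τ ⟩
          0# ∎
      ; nonnegative  = λ i j → *-nonneg 0≤τ (+-nonneg (Z.nonnegative i j) (Z₀.nonnegative i j))
      ; semidefinite = Z₁-semidefinite
      }

    bound-left : (t + 1#) * ⟨ J , Z₁ ⟩ ≈ ⟨ J , Z ⟩ + χ
    bound-left = begin
      (t + 1#) * ⟨ J , Z₁ ⟩                       ≈⟨ *-congˡ (⟨,⟩-scaledSum J Z Z₀ τ) ⟩
      (t + 1#) * (τ * (⟨ J , Z ⟩ + ⟨ J , Z₀ ⟩))   ≈⟨ *-assoc _ τ _ ⟨
      (t + 1#) * τ * (⟨ J , Z ⟩ + ⟨ J , Z₀ ⟩)     ≈⟨ *-congʳ (trans (*-comm _ τ) τ[t+1]≈1) ⟩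
      1# * (⟨ J , Z ⟩ + ⟨ J , Z₀ ⟩)               ≈⟨ *-identityˡ _ ⟩
      ⟨ J , Z ⟩ + ⟨ J , Z₀ ⟩                      ≈⟨ +-congˡ ⟨J,Z₀⟩≈χ ⟩
      ⟨ J , Z ⟩ + χ                               ∎

    bound-right : (t + 1#) * χ ≈ χ * t + χ
    bound-right = trans (distribʳ χ t 1#) (+-cong (*-comm t χ) (*-identityˡ χ))

  -- Moving the non-edges to the diagonal.

  module _ {n} (G : SimpleGraph n) {W : Matrix n}
           (W≥0 : Nonnegative W) (W⪰0 : PositiveSemidefinite W) where
    open PositiveSemidefinite W⪰0 using () renaming (symmetric to W-sym; nonnegative to W-psd)

    private
      a ā : Matrix n
      a = adjacencyMatrix G
      ā = adjacencyMatrix (complement G)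

      kept nonEdge : Matrix n
      kept i j = (I i j + a i j) * W i j
      nonEdge i j = ā i j * W i j

      -- The weighted degree in the complement: `I i j * degree i` less `nonEdge i j` is the
      -- weighted Laplacian of the complement.
      degree : Vector Carrier n
      degree i = sum (nonEdge i)

    -- W plus the sum over non-edges {i , j} of W i j * (eᵢ - eⱼ)(eᵢ - eⱼ)ᵀ.
    deleteNonEdges : Matrix n
    deleteNonEdges i j = kept i j + I i j * degree i

    private
      Z = deleteNonEdges

      nonEdge-sym : IsSymmetric nonEdge
      nonEdge-sym i j = *-cong (adjacencyMatrix-symmetric (complement G) i j) (W-sym i j)

      nonEdge-nonneg : Nonnegative nonEdge
      nonEdge-nonneg i j = *-nonneg (zeroOne-nonneg (adjacencyMatrix-zeroOne (complement G) i j)) (W≥0 i j)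

      I-sym : IsSymmetric (I {n})
      I-sym i j = trans (sym (*-identityʳ _)) (trans (I-balance (λ _ → 1#) i j) (*-identityʳ _))

      Z-sym : IsSymmetric Z
      Z-sym i j = +-cong
        (*-cong (+-cong (I-sym i j) (adjacencyMatrix-symmetric G i j)) (W-sym i j))
        (I-balance degree i j)

      kept+nonEdge : ∀ i j → kept i j + nonEdge i j ≈ W i j
      kept+nonEdge i j = begin
        (I i j + a i j) * W i j + ā i j * W i j   ≈⟨ distribʳ (W i j) _ _ ⟨
        (I i j + a i j + ā i j) * W i j           ≈⟨ *-congʳ (I+adjacency+complement≋J G i j) ⟩
        1# * W i j                                ≈⟨ *-identityˡ _ ⟩
        W i j                                     ∎

      sum²-I-degree : sum² (λ i j → I i j * degree i) ≈ sum² nonEdge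
      sum²-I-degree = sum-cong-≋ (λ i → I-sift (λ _ → degree i) i)

    -- Every row keeps its sum: what leaves the non-edges of row `i` returns on the diagonal as
    -- `degree i`.
    ⟨J,deleteNonEdges⟩ : ⟨ J , Z ⟩ ≈ sum² W
    ⟨J,deleteNonEdges⟩ = begin
      ⟨ J , Z ⟩
        ≈⟨ sum²-cong (λ i j → trans (*-identityˡ _) (Z-sym j i)) ⟩
      sum² Z
        ≈⟨ sum²-distrib-+ kept (λ i j → I i j * degree i) ⟩
      sum² kept + sum² (λ i j → I i j * degree i)
        ≈⟨ +-congˡ sum²-I-degree ⟩
      sum² kept + sum² nonEdge
        ≈⟨ sum²-distrib-+ kept nonEdge ⟨
      sum² (λ i j → kept i j + nonEdge i j)
        ≈⟨ sum²-cong kept+nonEdge ⟩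
      sum² W ∎

    ⟨I,deleteNonEdges⟩ : sum² (a ∘ W) + ⟨ I , Z ⟩ ≈ sum² W
    ⟨I,deleteNonEdges⟩ = begin
      sum² (a ∘ W) + ⟨ I , Z ⟩
        ≈⟨ +-congˡ (sum²-cong pointwise) ⟩
      sum² (a ∘ W) + sum² (λ i j → I i j * W i j + I i j * degree i)
        ≈⟨ +-congˡ (sum²-distrib-+ (I ∘ W) (λ i j → I i j * degree i)) ⟩
      sum² (a ∘ W) + (sum² (I ∘ W) + sum² (λ i j → I i j * degree i))
        ≈⟨ +-congˡ (+-congˡ sum²-I-degree) ⟩
      sum² (a ∘ W) + (sum² (I ∘ W) + sum² nonEdge)
        ≈⟨ +-assoc _ _ _ ⟨
      sum² (a ∘ W) + sum² (I ∘ W) + sum² nonEdge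
        ≈⟨ +-congʳ (sum²-distrib-+ (a ∘ W) (I ∘ W)) ⟨
      sum² (λ i j → a i j * W i j + I i j * W i j) + sum² nonEdge
        ≈⟨ sum²-distrib-+ (λ i j → a i j * W i j + I i j * W i j) nonEdge ⟨
      sum² (λ i j → a i j * W i j + I i j * W i j + nonEdge i j)
        ≈⟨ sum²-cong (λ i j → trans
             (+-congʳ (trans (+-comm _ _) (sym (distribʳ (W i j) (I i j) (a i j)))))
             (kept+nonEdge i j)) ⟩
      sum² W ∎
      where
      pointwise : ∀ i j → I i j * Z j i ≈ I i j * W i j + I i j * degree i
      pointwise i j = begin
        I i j * Z j i
          ≈⟨ *-congˡ (Z-sym j i) ⟩
        I i j * ((I i j + a i j) * W i j + I i j * degree i)
          ≈⟨ solve 4 (λ e a w d → e :* ((e :+ a) :* w :+ e :* d)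
                               := e :* e :* w :+ e :* e :* d :+ e :* a :* w)
               refl (I i j) (a i j) (W i j) (degree i) ⟩
        I i j * I i j * W i j + I i j * I i j * degree i + I i j * a i j * W i j
          ≈⟨ +-cong (+-cong (*-congʳ II≈I) (*-congʳ II≈I))
               (trans (*-congʳ (I∘adjacency≋O G i j)) (zeroˡ _)) ⟩
        I i j * W i j + I i j * degree i + 0#
          ≈⟨ +-identityʳ _ ⟩
        I i j * W i j + I i j * degree i ∎
        where
        II≈I = zeroOne-idem (I-zeroOne i j)

    private
      -- Positivity of the weighted Laplacian. Weighting `2xy≤x²+y²` by `nonEdge i j` and summing
      -- gives twice the claim, as by symmetry both squares contribute the same total.
      quad-nonEdge≤ : ∀ v → quad nonEdge v ≤ sum² (λ i j → v i * nonEdge i j * v i)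
      quad-nonEdge≤ v = x+x≤y+y⇒x≤y (≤-resp
        (sum²-distrib-+ (λ i j → v i * nonEdge i j * v j) (λ i j → v i * nonEdge i j * v j))
        (trans (sum²-distrib-+ (λ i j → v i * nonEdge i j * v i) (λ i j → v j * nonEdge i j * v j))
               (+-congˡ transposed))
        (sum²-mono-≤ λ i j → ≤-resp
          (solve 3 (λ m x y → m :* (x :* y :+ x :* y) := x :* m :* y :+ x :* m :* y)
            refl (nonEdge i j) (v i) (v j))
          (solve 3 (λ m x y → m :* (x :* x :+ y :* y) := x :* m :* x :+ y :* m :* y)
            refl (nonEdge i j) (v i) (v j))
          (*-monoˡ-≤ (nonEdge i j) (nonEdge-nonneg i j) (2xy≤x²+y² (v i) (v j)))))
        where
        transposed : sum² (λ i j → v j * nonEdge i j * v j) ≈ sum² (λ i j → v i * nonEdge i j * v i)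
        transposed = trans (∑-comm (λ i j → v j * nonEdge i j * v j))
          (sum²-cong (λ i j → *-congʳ (*-congˡ (nonEdge-sym j i))))

      -- `W` and `Z` share `kept`, so only the non-edges and the diagonal that replaces them are
      -- compared.
      quad-W≤quad-Z : ∀ v → quad W v ≤ quad Z v
      quad-W≤quad-Z v = ≤-resp (sym W-split) (sym Z-split) (+-mono-≤ ≤-refl (quad-nonEdge≤ v))
        where
        W-split : quad W v ≈ quad kept v + quad nonEdge v
        W-split = trans
          (sum²-cong λ i j → trans (*-congʳ (*-congˡ (sym (kept+nonEdge i j))))
            (solve 4 (λ x k m y → x :* (k :+ m) :* y := x :* k :* y :+ x :* m :* y)
              refl (v i) (kept i j) (nonEdge i j) (v j)))
          (sum²-distrib-+ (λ i j → v i * kept i j * v j) (λ i j → v i * nonEdge i j * v j))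
        diagonal : ∀ i → sum (λ j → I i j * (v i * degree i * v j)) ≈ sum (λ j → v i * nonEdge i j * v i)
        diagonal i = begin
          sum (λ j → I i j * (v i * degree i * v j))
            ≈⟨ I-sift (λ j → v i * degree i * v j) i ⟩
          v i * degree i * v i
            ≈⟨ *-congʳ (*-distribˡ-sum (v i) (nonEdge i)) ⟩
          sum (λ j → v i * nonEdge i j) * v i
            ≈⟨ *-distribʳ-sum (v i) (λ j → v i * nonEdge i j) ⟩
          sum (λ j → v i * nonEdge i j * v i) ∎
        Z-split : quad Z v ≈ quad kept v + sum² (λ i j → v i * nonEdge i j * v i)
        Z-split = begin
          quad Z v
            ≈⟨ sum²-cong (λ i j →
                 solve 5 (λ x k e d y → x :* (k :+ e :* d) :* y := x :* k :* y :+ e :* (x :* d :* y))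
                   refl (v i) (kept i j) (I i j) (degree i) (v j)) ⟩
          sum² (λ i j → v i * kept i j * v j + I i j * (v i * degree i * v j))
            ≈⟨ sum²-distrib-+ (λ i j → v i * kept i j * v j) (λ i j → I i j * (v i * degree i * v j)) ⟩
          quad kept v + sum² (λ i j → I i j * (v i * degree i * v j))
            ≈⟨ +-congˡ (sum-cong-≋ diagonal) ⟩
          quad kept v + sum² (λ i j → v i * nonEdge i j * v i) ∎

    deleteNonEdges-inCone : InCone G deleteNonEdges
    deleteNonEdges-inCone = record
      { offEdges     = offEdges
      ; nonnegative  = λ i j → +-nonneg
          (*-nonneg (+-nonneg (zeroOne-nonneg (I-zeroOne i j))
                              (zeroOne-nonneg (adjacencyMatrix-zeroOne G i j))) (W≥0 i j))
          (*-nonneg (zeroOne-nonneg (I-zeroOne i j)) (sum-nonneg (nonEdge-nonneg i)))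
      ; semidefinite = record
        { symmetric   = Z-sym
        ; nonnegative = λ v → ≤-trans (W-psd v) (quad-W≤quad-Z v)
        }
      }
      where
      offEdges : Z ∘ ā ≋ O
      offEdges i j = begin
        ((I i j + a i j) * W i j + I i j * degree i) * ā i j
          -- Each term carries the indicator of the diagonal or of the edges, and both are disjoint
          -- from the complement.
          ≈⟨ solve 5 (λ e a c w d → ((e :+ a) :* w :+ e :* d) :* c
                                 := e :* c :* (w :+ d) :+ a :* c :* w)
               refl (I i j) (a i j) (ā i j) (W i j) (degree i) ⟩
        I i j * ā i j * (W i j + degree i) + a i j * ā i j * W i j
          ≈⟨ +-cong (trans (*-congʳ (I∘adjacency≋O (complement G) i j)) (zeroˡ _))
                    (trans (*-congʳ (adjacency∘complement≋O G i j)) (zeroˡ _)) ⟩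
        0# + 0#
          ≈⟨ +-identityʳ 0# ⟩
        0# ∎

  -- The weight carried by the edges, and the final estimate.

  -- `cone-bound` for `Z` says that `r * S` is at most the trace `t`. Edge sum and `t` add up to
  -- `S`, so `r * S` can be cancelled.
  edge-sum-bound : ∀ {n} {G : SimpleGraph n} {χ} (isχ : IsVectorChromaticNumber G χ) {W : Matrix n} →
    Nonnegative W → PositiveSemidefinite W →
    sum² (adjacencyMatrix G ∘ W) ≤ (1# - reciprocal χ (χ#0 isχ)) * sum² W
  edge-sum-bound {G = G} {χ} isχ {W} W≥0 W⪰0 = +-cancelʳ-≤ (r * S)
    (≤-resp refl (trans (⟨I,deleteNonEdges⟩ G W≥0 W⪰0) S-split) (+-mono-≤ ≤-refl rS≤t))
    where
    Z = deleteNonEdges G W≥0 W⪰0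
    S = sum² W
    t = ⟨ I , Z ⟩
    r = reciprocal χ (χ#0 isχ)

    rχ≈1 : r * χ ≈ 1#
    rχ≈1 = proj₁ (proj₂ (#0⇒invertible (χ#0 isχ)))

    rS≤t : r * S ≤ t
    rS≤t = ≤-resp
      (*-congˡ (⟨J,deleteNonEdges⟩ G W≥0 W⪰0))
      (trans (sym (*-assoc r χ t)) (trans (*-congʳ rχ≈1) (*-identityˡ t)))
      (*-monoˡ-≤ r (inverse-nonneg (<-≤-trans 0<1 (1≤χ isχ)) rχ≈1)
        (cone-bound isχ (deleteNonEdges-inCone G W≥0 W⪰0)))

    S-split : S ≈ (1# - r) * S + r * S
    S-split = begin
      S                         ≈⟨ *-identityˡ S ⟨
      1# * S                    ≈⟨ *-congʳ (x+[y-x]≈y r 1#) ⟨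
      (r + (1# - r)) * S        ≈⟨ *-congʳ (+-comm r _) ⟩
      (1# - r + r) * S          ≈⟨ distribʳ S (1# - r) r ⟩
      (1# - r) * S + r * S      ∎

lemma2 : ∀ {c ℓ₁ ℓ₂ : Level} (ℝ : RealNumbers c ℓ₁ ℓ₂) →
    let open RealNumbers ℝ
        open RealMatrices ℝ
    in
    ∀ {n : ℕ} (X Y : Matrix n) →
    IsSymmetric X → IsSymmetric Y →
    PositiveSemidefinite X → HasZeroDiagonal Y →
    (A : Matrix n) → IsZeroOne A → SameSupport A (X ∘ Y) →
    (G : SimpleGraph n) → adjacencyMatrix G ≋ A →
    (χ : Carrier) (isχ : IsVectorChromaticNumber G χ) →
    ⟨ X , Y ⟩ * ⟨ X , Y ⟩ ≤ (1# - reciprocal χ (χ#0 isχ)) * ⟨ X , X ⟩ * ⟨ Y , Y ⟩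
lemma2 ℝ {n} X Y X-sym Y-sym X⪰0 _ A _ A-support G G≋A χ isχ =
  ≤-trans
    (≤-resp (*-cong (sym ⟨X,Y⟩≈) (sym ⟨X,Y⟩≈)) (*-cong (sum²-cong P∘P≋a∘W) (sym ⟨Y,Y⟩≈))
      (cauchySchwarz P Y))
    (≤-resp (*-comm _ _) (trans (*-comm _ _) (*-congʳ (*-congˡ (sym ⟨X,X⟩≈))))
      (*-monoˡ-≤ ⟨ Y , Y ⟩ 0≤⟨Y,Y⟩
        (edge-sum-bound isχ (λ i j → square-nonneg (X i j)) (schurProduct X⪰0 X⪰0))))
  where
  open RealNumbers ℝ
  open RealMatrices ℝ
  open Spectral ℝ
  open RingSolver commutativeSemiring using (solve; _:*_; _:=_)

  a P : Matrix n
  a = adjacencyMatrix G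
  -- Restricting `X` to the edges keeps the pairing with `Y` but leaves only the edge part of
  -- `⟨ X , X ⟩`, so Cauchy-Schwarz is applied to `P` and `Y`.
  P = a ∘ X

  ⟨X,X⟩≈ : ⟨ X , X ⟩ ≈ sum² (X ∘ X)
  ⟨X,X⟩≈ = sum²-cong (λ i j → *-congˡ (X-sym j i))

  ⟨Y,Y⟩≈ : ⟨ Y , Y ⟩ ≈ sum² (Y ∘ Y)
  ⟨Y,Y⟩≈ = sum²-cong (λ i j → *-congˡ (Y-sym j i))

  0≤⟨Y,Y⟩ : 0# ≤ ⟨ Y , Y ⟩
  0≤⟨Y,Y⟩ = ≤-resp refl (sym ⟨Y,Y⟩≈) (sum²-nonneg (λ i j → square-nonneg (Y i j)))

  XY≈PY : ∀ i j → (X ∘ Y) i j ≈ (P ∘ Y) i j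
  XY≈PY i j with adjacencyMatrix-zeroOne G i j
  ... | inj₂ a≈1 = *-congʳ (sym (trans (*-congʳ a≈1) (*-identityˡ _)))
  ... | inj₁ a≈0 = trans XY≈0 (sym (trans (*-congʳ (trans (*-congʳ a≈0) (zeroˡ _))) (zeroˡ _)))
    where
    -- A nonzero entry would make `A i j`, and with it `a i j`, nonzero; stability turns this
    -- refutation into an equation.
    XY≈0 : (X ∘ Y) i j ≈ 0#
    XY≈0 = ≈-stable λ XY≉0 →
      Equivalence.from (A-support i j) XY≉0 (trans (sym (G≋A i j)) a≈0)

  ⟨X,Y⟩≈ : ⟨ X , Y ⟩ ≈ sum² (P ∘ Y)
  ⟨X,Y⟩≈ = sum²-cong (λ i j → trans (*-congˡ (Y-sym j i)) (XY≈PY i j))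

  P∘P≋a∘W : P ∘ P ≋ a ∘ (X ∘ X)
  P∘P≋a∘W i j = trans
    (solve 2 (λ a x → a :* x :* (a :* x) := a :* a :* (x :* x)) refl (a i j) (X i j))
    (*-congʳ (zeroOne-idem (adjacencyMatrix-zeroOne G i j)))
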